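{- Let $b\geq 3$ be an integer, and let $\alpha$ and $\beta$ be integers with $\alpha\beta\neq 0$. Further, let $q\geq 5$ be a prime, and let $\mathcal{C}$ be a $b$-primitive covering system with moduli $m_{(j,\overline{j},j')}=2^j3^{\overline{j}}q^{j'}$ for $0\leq j\leq q$, $1\leq\overline{j}\leq q$, and $0\leq j'\leq 1$ (one congruence for each such modulus). Lastly, let $M=\operatorname{lcm}\left(\{2^q,\,3^q,\,b-1,\,q\}\cup\mathcal{P}_b(\mathcal{C})\right)$. Then there exists an integer $T$ such that for all nonnegative integers $t\equiv T\pmod{M}$ with $(tb^t+\alpha)b+\beta\geq\max\mathcal{P}_b(\mathcal{C})$, we have $\gcd(tb^t+\alpha+\beta,\,b-1)=1$, and the expression $(tb^t+\alpha)b^n+\beta$ is composite for all positive integers $n$.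
   Context: A covering system (of the integers) is a finite collection of congruences $r_i\pmod{m_i}$, $1\le i\le \nu$, such that every integer $n$ satisfies $n\equiv r_i\pmod{m_i}$ for at least one $i$. For integers $b\geq 2$ and $w\geq 1$, a prime $p$ is a primitive prime divisor of $b^w-1$ if $p\mid b^w-1$ and $p\nmid b^\ell-1$ for all $1\leq \ell<w$. A covering system $\mathcal{C}=\{r_i\pmod{m_i}:1\leq i\leq\nu\}$ is called $b$-primitive if there exist distinct primes $p_1,\ldots,p_\nu$ such that, for each $1\leq i\leq\nu$, $p_i$ is a primitive prime divisor of $b^{m_i}-1$. For a given $b$-primitive covering system $\mathcal{C}$, $\mathcal{P}_b(\mathcal{C})=\{p_1,\ldots,p_\nu\}$ denotes a (fixed, arbitrary) choice of such primes. -}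

module Defs where

open import Data.Nat.Base as ℕ using (ℕ; suc; NonZero)
open import Data.Nat.Divisibility using (_∣_)
open import Data.Nat.LCM using (lcm)
open import Data.Nat.Primality using (Prime; Composite)
open import Data.Integer.Base as ℤ using (ℤ; +_; ∣_∣)
open import Data.Integer.Divisibility as ℤ using ()
open import Data.List.Base using (List; []; _∷_; map; foldr; upTo; applyUpTo; cartesianProduct)
open import Data.List.Extrema.Nat using (max)
open import Data.List.Relation.Binary.Permutation.Propositional using (_↭_)
open import Data.List.Relation.Binary.Pointwise.Base using (Pointwise)
open import Data.List.Relation.Unary.Any using (Any)
open import Data.List.Relation.Unary.Unique.Propositional using (Unique)
open import Data.Product.Base using (_×_; _,_)
open import Relation.Nullary.Negation.Core using (¬_)

infix 4 _≡_[mod_]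

_≡_[mod_] : ℤ → ℤ → ℕ → Set
x ≡ y [mod m ] = (+ m) ℤ.∣ (x ℤ.- y)

record Congruence : Set where
  field
    residue : ℤ
    modulus : ℕ
    .{{modulus≢0}} : NonZero modulus

open Congruence public

record CoveringSystem : Set where
  field
    congruences : List Congruence
    covers : ∀ (n : ℤ) → Any (λ c → n ≡ residue c [mod modulus c ]) congruences

  moduli : List ℕ
  moduli = map modulus congruences

open CoveringSystem public

-- Used for b ≥ 2 and w ≥ 1, so the truncated subtractions are exact.
record PrimitivePrimeDivisor (b w p : ℕ) : Set where
  field
    isPrime   : Prime p
    divides   : p ∣ b ℕ.^ w ℕ.∸ 1
    minimal   : ∀ l → 1 ℕ.≤ l → l ℕ.< w → ¬ (p ∣ b ℕ.^ l ℕ.∸ 1)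

-- Data rather than mere existence: the field `primes` is the
-- chosen set 𝒫_b(𝒞), its i-th entry belonging to the i-th congruence.
record BPrimitive (b : ℕ) (C : CoveringSystem) : Set where
  field
    primes   : List ℕ
    distinct : Unique primes
    areDivisors : Pointwise (PrimitivePrimeDivisor b) (moduli C) primes

open BPrimitive public

-- 2^j 3^k q^l for 0 ≤ j ≤ q, 1 ≤ k ≤ q, 0 ≤ l ≤ 1, each triple listed once.
prescribedModuli : ℕ → List ℕ
prescribedModuli q =
  map (λ (j , k , l) → 2 ℕ.^ j ℕ.* 3 ℕ.^ k ℕ.* q ℕ.^ l)
      (cartesianProduct (upTo (suc q)) (cartesianProduct (applyUpTo suc q) (upTo 2)))

-- `↭` rather than `≡`: a system is an unordered collection.
HasPrescribedModuli : ℕ → CoveringSystem → Set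
HasPrescribedModuli q C = moduli C ↭ prescribedModuli q

lcmList : List ℕ → ℕ
lcmList = foldr lcm 1

-- The default 0 is only returned for an empty list of primes, which
-- cannot occur since a covering system is nonempty.
maxPrime : {b : ℕ} {C : CoveringSystem} → BPrimitive b C → ℕ
maxPrime P = max 0 (primes P)

-- An integer of either sign is composite when its absolute value is; in
-- particular 0 and ±1 are not composite.
Compositeℤ : ℤ → Set
Compositeℤ z = Composite ∣ z ∣

{-# OPTIONS --safe #-}
module Submission where

open import Defs
open import Data.Nat.Base as ℕ using (ℕ; zero; suc; NonZero)
import Data.Nat.Properties as ℕ
import Data.Nat.Divisibility as ℕ
import Data.Nat.DivMod as ℕ
import Data.Nat.GCD as ℕ
open import Data.Nat.Coprimality as Coprimality using (Coprime; coprime-Bézout; coprime-divisor)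
open import Data.Nat.DivMod using (_mod_)
open import Data.Nat.GCD using (module Bézout)
open import Data.Nat.LCM using (lcm; m∣lcm[m,n]; n∣lcm[m,n]; lcm-least; gcd*lcm)
open import Data.Nat.Primality
  using (Prime; ¬prime[1]; prime[2]; prime?; prime⇒irreducible; prime⇒nonZero; prime⇒nonTrivial)
open import Data.Nat.Tactic.RingSolver using () renaming (solve-∀ to ℕ-solve-∀)
open import Data.Integer.Base as ℤ using (ℤ; +_; -[1+_]; _+_; _-_; -_; _*_; _^_; _≤_; _≥_; 0ℤ; 1ℤ; ∣_∣; +≤+)
import Data.Integer.Properties as ℤ
import Data.Integer.DivMod as ℤ
open import Data.Integer.Divisibility.Signed as Signed using (∣ᵤ⇒∣; ∣⇒∣ᵤ)
open import Data.Integer.GCD using (gcd)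
open import Data.Integer.Tactic.RingSolver using (solve-∀)
open import Data.Fin using (Fin; toℕ; #_)
import Data.Fin.Base as Fin
import Data.Fin.Properties as Fin
open import Data.List.Base using (List; []; _∷_; map; upTo; applyUpTo; cartesianProduct; filter)
open import Data.List.Extrema.Nat using (argmax-sel; xs≤max)
open import Data.List.Membership.Propositional using (_∈_; find)
open import Data.List.Membership.Propositional.Properties
  using (∈-map⁺; ∈-map⁻; ∈-cartesianProduct⁻; ∈-upTo⁻; ∈-applyUpTo⁻)
open import Data.List.Relation.Binary.Permutation.Propositional.Properties using (∈-resp-↭)
open import Data.List.Relation.Binary.Pointwise.Base using (Pointwise; []; _∷_)
open import Data.List.Relation.Unary.All as All using (All; []; _∷_)
import Data.List.Relation.Unary.All.Properties as All
open import Data.List.Relation.Unary.AllPairs as AllPairs using (AllPairs; []; _∷_)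
import Data.List.Relation.Unary.AllPairs.Properties as AllPairs
open import Data.List.Relation.Unary.Any using (Any; here; there)
import Data.List.Relation.Unary.Any.Properties as Any
open import Data.List.Relation.Unary.Unique.Propositional using (Unique)
open import Data.Product.Base using (_×_; _,_; ∃-syntax; ∃₂; proj₁; proj₂)
open import Data.Sum.Base using (inj₁; inj₂)
open import Data.Empty using (⊥)
open import Function.Base using (_on_; _∘_; id; case_of_)
open import Relation.Binary.Definitions using (tri<; tri≈; tri>)
open import Relation.Binary.PropositionalEquality.Core
  using (_≡_; _≢_; refl; sym; trans; cong; cong₂; subst; subst₂)
open import Relation.Nullary.Decidable.Core
  using (Dec; yes; no; map′; recompute; from-yes; from-no; ¬?; _×-dec_; _→-dec_)
open import Relation.Nullary.Negation using (¬_; contradiction)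

-- Write X(t,n) = (t b^t + α) b^n + β. Once t is fixed modulo the order m_i of b modulo p_i, the
-- condition that p_i divides X(t,n) for all n ≡ r_i (mod m_i) is linear in t modulo p_i, so the Chinese
-- remainder theorem yields a class of t modulo M for which every X(t,n) is divisible by one of the
-- primes. Such a value is composite unless |X(t,n)| ≤ P = max p_i, and this can really happen: X(t,1) may
-- equal P, and for negative t b^t + α the values X(t,n) decrease through 0.
-- However, at most two t in such classes are exceptional in this way. All such t have t b^t in one
-- residue class modulo P. Suppose t₃ < t₂ < t₁ are exceptional and put x_i = -(t_i b^(t_i) + α). Then
-- x₁ > 0, as otherwise X(t₁,n) ≥ X(t₁,1) > X(t₃,1) ≥ P, while x₂ b^(n₂) and x₃ b^(n₃) differ by at
-- most 2P ≤ 2 (x₃ - x₂), and the growth of t b^t gives 2 (x₃ - x₂) ≤ x₂ - x₁. These are incompatible for b ≥ 3.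
-- So of three classes, distinguished modulo lcm(2^q 3^q, b - 1), one contains no exceptional t;
-- a bounded search finds it.

-- Calculus of integer congruences.

infix 4 _≋_⟨_⟩

-- A record, because x, y and m cannot be inferred from the unfolding of `_≡_[mod_]`.
record _≋_⟨_⟩ (x y : ℤ) (m : ℕ) : Set where
  constructor ≋-intro
  field difference : (+ m) Signed.∣ (x - y)
open _≋_⟨_⟩

private
  variable
    x y z u v : ℤ
    b k m n p w : ℕ

fromMod : ∀ x y m → x ≡ y [mod m ] → x ≋ y ⟨ m ⟩
fromMod x y m d = ≋-intro (∣ᵤ⇒∣ d)

toMod : x ≋ y ⟨ m ⟩ → x ≡ y [mod m ]
toMod c = ∣⇒∣ᵤ (difference c)

≋-witness : ∀ k → x ≡ y + k * + m → x ≋ y ⟨ m ⟩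
≋-witness {y = y} {m} k refl = ≋-intro (Signed.divides k (lemma y (k * + m)))
  where
  lemma : ∀ y d → y + d - y ≡ d
  lemma = solve-∀

≋-refl : x ≋ x ⟨ m ⟩
≋-refl {x} {m} = ≋-witness 0ℤ (sym (ℤ.+-identityʳ x))

≋-reflexive : x ≡ y → x ≋ y ⟨ m ⟩
≋-reflexive refl = ≋-refl

≋-sym : x ≋ y ⟨ m ⟩ → y ≋ x ⟨ m ⟩
≋-sym {x} {y} (≋-intro d) = ≋-intro (subst (_ Signed.∣_) (lemma x y) (Signed.∣m⇒∣-m d))
  where
  lemma : ∀ x y → - (x - y) ≡ y - x
  lemma = solve-∀

≋-trans : x ≋ y ⟨ m ⟩ → y ≋ z ⟨ m ⟩ → x ≋ z ⟨ m ⟩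
≋-trans {x} {y} {z = z} (≋-intro d) (≋-intro e) =
  ≋-intro (subst (_ Signed.∣_) (lemma x y z) (Signed.∣m∣n⇒∣m+n d e))
  where
  lemma : ∀ x y z → (x - y) + (y - z) ≡ x - z
  lemma = solve-∀

≋-+ : x ≋ y ⟨ m ⟩ → u ≋ v ⟨ m ⟩ → x + u ≋ y + v ⟨ m ⟩
≋-+ {x} {y} {u = u} {v} (≋-intro d) (≋-intro e) =
  ≋-intro (subst (_ Signed.∣_) (lemma x y u v) (Signed.∣m∣n⇒∣m+n d e))
  where
  lemma : ∀ x y u v → (x - y) + (u - v) ≡ (x + u) - (y + v)
  lemma = solve-∀

≋-* : x ≋ y ⟨ m ⟩ → u ≋ v ⟨ m ⟩ → x * u ≋ y * v ⟨ m ⟩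
≋-* {x} {y} {u = u} {v} (≋-intro d) (≋-intro e) =
  ≋-intro (subst (_ Signed.∣_) (lemma x y u v)
    (Signed.∣m∣n⇒∣m+n (Signed.∣m⇒∣m*n u d) (Signed.∣n⇒∣m*n y e)))
  where
  lemma : ∀ x y u v → (x - y) * u + y * (u - v) ≡ x * u - y * v
  lemma = solve-∀

≋-^ : ∀ n → x ≋ y ⟨ m ⟩ → x ^ n ≋ y ^ n ⟨ m ⟩
≋-^ zero    c = ≋-refl
≋-^ (suc n) c = ≋-* c (≋-^ n c)

≋-weaken : k ℕ.∣ m → x ≋ y ⟨ m ⟩ → x ≋ y ⟨ k ⟩
≋-weaken k∣m (≋-intro d) = ≋-intro (Signed.∣-trans (∣ᵤ⇒∣ k∣m) d)

∣⇒≋0 : (+ m) Signed.∣ x → x ≋ 0ℤ ⟨ m ⟩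
∣⇒≋0 {x = x} d = ≋-intro (subst (_ Signed.∣_) (sym (ℤ.+-identityʳ x)) d)

≋0⇒∣ : x ≋ 0ℤ ⟨ m ⟩ → (+ m) Signed.∣ x
≋0⇒∣ {x} (≋-intro d) = subst (_ Signed.∣_) (ℤ.+-identityʳ x) d

≋-cancel-unit : u * v ≋ 1ℤ ⟨ m ⟩ → x * u ≋ 0ℤ ⟨ m ⟩ → x ≋ 0ℤ ⟨ m ⟩
≋-cancel-unit {u} {v} {x = x} uv≋1 xu≋0 =
  ≋-trans (≋-reflexive (sym (ℤ.*-identityʳ x)))
    (≋-trans (≋-* (≋-refl {x}) (≋-sym uv≋1))
      (≋-trans (≋-reflexive (sym (ℤ.*-assoc x u v))) (≋-* xu≋0 (≋-refl {v}))))

-- Bézout combinations and the Chinese remainder theorem.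

pos-eq : ∀ a b c d → 1 ℕ.+ a ℕ.* c ≡ b ℕ.* d → 1ℤ + + a * + c ≡ + b * + d
pos-eq a b c d e = trans (cong (_+_ 1ℤ) (sym (ℤ.pos-* a c))) (trans (cong +_ e) (ℤ.pos-* b d))

coprime⇒combination : Coprime m n → ∃[ k ] ∃[ l ] k * + m + l * + n ≡ 1ℤ
coprime⇒combination {m} {n} cop with coprime-Bézout cop
... | Bézout.+- k l eq =
  + k , - (+ l) , trans (cong (_+ - (+ l) * + n) (sym (pos-eq l k n m eq))) (lemma (+ l) (+ n))
  where
  lemma : ∀ a c → (1ℤ + a * c) + - a * c ≡ 1ℤ
  lemma = solve-∀
... | Bézout.-+ k l eq =
  - (+ k) , + l , trans (cong (_+_ (- (+ k) * + m)) (sym (pos-eq k l m n eq))) (lemma (+ k) (+ m))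
  where
  lemma : ∀ a c → - a * c + (1ℤ + a * c) ≡ 1ℤ
  lemma = solve-∀

-- With k m + l n = 1, the number l n is 1 modulo m and 0 modulo n, and k m the reverse; these are
-- the weights of x and y.
chinese : Coprime m n → ∀ x y → ∃[ z ] z ≋ x ⟨ m ⟩ × z ≋ y ⟨ n ⟩
chinese {m} {n} cop x y with k , l , eq ← coprime⇒combination cop =
  x * (l * + n) + y * (k * + m)
  , ≋-witness ((y - x) * k) (trans (lemma₁ x y k l (+ m) (+ n))
      (cong (_+ (y - x) * k * + m) (trans (cong (x *_) eq) (ℤ.*-identityʳ x))))
  , ≋-witness ((x - y) * l) (trans (lemma₂ x y k l (+ m) (+ n))
      (cong (_+ (x - y) * l * + n) (trans (cong (y *_) eq) (ℤ.*-identityʳ y))))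
  where
  lemma₁ : ∀ x y k l a b → x * (l * b) + y * (k * a) ≡ x * (k * a + l * b) + (y - x) * k * a
  lemma₁ = solve-∀
  lemma₂ : ∀ x y k l a b → x * (l * b) + y * (k * a) ≡ y * (k * a + l * b) + (x - y) * l * b
  lemma₂ = solve-∀

-- Powers of an element of finite order.

module _ {a : ℤ} (a^m≋1 : a ^ m ≋ 1ℤ ⟨ n ⟩) where

  ^-≋-multiple : ∀ k → a ^ (k ℕ.* m) ≋ 1ℤ ⟨ n ⟩
  ^-≋-multiple k = ≋-trans
    (≋-reflexive (trans (cong (a ^_) (ℕ.*-comm k m)) (sym (ℤ.^-*-assoc a m k))))
    (≋-trans (≋-^ k a^m≋1) (≋-reflexive (ℤ.^-zeroˡ k)))

  private
    ^-≋-shift : ∀ i j → i ℕ.≤ j → + j ≋ + i ⟨ m ⟩ → a ^ j ≋ a ^ i ⟨ n ⟩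
    ^-≋-shift i j i≤j (≋-intro d) with ∣⇒∣ᵤ (subst (_ Signed.∣_) eq d)
      where
      eq : + j - + i ≡ + (j ℕ.∸ i)
      eq = trans (ℤ.m-n≡m⊖n j i) (ℤ.⊖-≥ i≤j)
    ... | ℕ.divides k eq = ≋-trans (≋-reflexive split)
      (≋-trans (≋-* (^-≋-multiple k) (≋-refl {a ^ i})) (≋-reflexive (ℤ.*-identityˡ (a ^ i))))
      where
      split : a ^ j ≡ a ^ (k ℕ.* m) * a ^ i
      split = trans (cong (a ^_) (trans (sym (ℕ.m∸n+n≡m i≤j)) (cong (ℕ._+ i) eq)))
        (ℤ.^-distribˡ-+-* a (k ℕ.* m) i)

  ^-≋-periodic : ∀ i j → + i ≋ + j ⟨ m ⟩ → a ^ i ≋ a ^ j ⟨ n ⟩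
  ^-≋-periodic i j c with ℕ.≤-total i j
  ... | inj₁ i≤j = ≋-sym (^-≋-shift i j i≤j (≋-sym c))
  ... | inj₂ j≤i = ^-≋-shift j i j≤i c

  -- As k + k (m - 1) = k m, the inverse of a power is again a power with a natural exponent.
  ^-≋-inverse : .{{NonZero m}} → ∀ k → a ^ k * a ^ (k ℕ.* ℕ.pred m) ≋ 1ℤ ⟨ n ⟩
  ^-≋-inverse k = ≋-trans (≋-reflexive (trans (sym (ℤ.^-distribˡ-+-* a k _)) (cong (a ^_) eq)))
    (^-≋-multiple k)
    where
    eq : k ℕ.+ k ℕ.* ℕ.pred m ≡ k ℕ.* m
    eq = trans (sym (ℕ.*-suc k (ℕ.pred m))) (cong (k ℕ.*_) (ℕ.suc-pred m))

-- Primitive prime divisors and coprimality.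

open PrimitivePrimeDivisor

pos-^ : ∀ b n → + (b ℕ.^ n) ≡ (+ b) ^ n
pos-^ b zero    = refl
pos-^ b (suc n) = trans (ℤ.pos-* b (b ℕ.^ n)) (cong (_*_ (+ b)) (pos-^ b n))

pos-∸ : n ℕ.≤ m → + (m ℕ.∸ n) ≡ + m - + n
pos-∸ {n} {m} n≤m = sym (trans (ℤ.m-n≡m⊖n m n) (ℤ.⊖-≥ n≤m))

-- From b ≥ 1 follows b^w ≥ 1, so the truncated subtraction is exact and agrees with the one in the
-- integers.
∣∸1⇔≋1 : b ℕ.≥ 1 → ∀ w → (p ℕ.∣ b ℕ.^ w ℕ.∸ 1 → (+ b) ^ w ≋ 1ℤ ⟨ p ⟩)
                       × ((+ b) ^ w ≋ 1ℤ ⟨ p ⟩ → p ℕ.∣ b ℕ.^ w ℕ.∸ 1)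
∣∸1⇔≋1 {b} {p} b≥1 w =
    (λ d → ≋-intro (∣ᵤ⇒∣ (subst (p ℕ.∣_) (cong ∣_∣ eq) d)))
  , (λ c → subst (p ℕ.∣_) (sym (cong ∣_∣ eq)) (toMod c))
  where
  b^w≥1 : 1 ℕ.≤ b ℕ.^ w
  b^w≥1 = ℕ.m^n>0 b {{ℕ.>-nonZero b≥1}} w
  eq : + (b ℕ.^ w ℕ.∸ 1) ≡ (+ b) ^ w - 1ℤ
  eq = trans (pos-∸ b^w≥1) (cong (_- 1ℤ) (pos-^ b w))

prime∧∤⇒coprime : Prime p → ¬ p ℕ.∣ n → Coprime p n
prime∧∤⇒coprime pp p∤n (d∣p , d∣n) with prime⇒irreducible pp d∣p
... | inj₁ d≡1  = d≡1
... | inj₂ refl = contradiction d∣n p∤n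

prime≢⇒coprime : Prime p → Prime n → p ≢ n → Coprime p n
prime≢⇒coprime pp pn p≢n = prime∧∤⇒coprime pp λ p∣n → case prime⇒irreducible pn p∣n of λ where
    (inj₁ p≡1) → contradiction (subst Prime p≡1 pp) ¬prime[1]
    (inj₂ p≡n) → p≢n p≡n

coprime-* : Coprime p m → Coprime p n → Coprime p (m ℕ.* n)
coprime-* c c′ (d∣p , d∣mn) =
  c′ (d∣p , coprime-divisor (λ (e∣d , e∣m) → c (ℕ.∣-trans e∣d d∣p , e∣m)) d∣mn)

coprime-^ : Coprime m n → ∀ k → Coprime m (n ℕ.^ k)
coprime-^ c zero    (_ , d∣1) = ℕ.∣1⇒≡1 d∣1
coprime-^ c (suc k) = coprime-* c (coprime-^ c k)

coprime⇒*∣ : ∀ {k} → Coprime m n → m ℕ.∣ k → n ℕ.∣ k → m ℕ.* n ℕ.∣ k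
coprime⇒*∣ {m} {n} c (ℕ.divides j refl) n∣jm =
  subst (m ℕ.* n ℕ.∣_) (ℕ.*-comm m j)
    (ℕ.*-monoʳ-∣ m (coprime-divisor (Coprimality.sym c) (subst (n ℕ.∣_) (ℕ.*-comm j m) n∣jm)))

%⇒≋ : ∀ {i j} .{{_ : NonZero p}} → i ℕ.% p ≡ j ℕ.% p → + i ≋ + j ⟨ p ⟩
%⇒≋ {p} {i} {j} eq = ≋-trans (≋-% i) (≋-trans (≋-reflexive (cong +_ eq)) (≋-sym (≋-% j)))
  where
  ≋-% : ∀ k → + k ≋ + (k ℕ.% p) ⟨ p ⟩
  ≋-% k = ≋-witness (+ (k ℕ./ p)) (trans (cong +_ (ℕ.m≡m%n+[m/n]*n k p))
    (cong (_+_ (+ (k ℕ.% p))) (ℤ.pos-* (k ℕ./ p) p)))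

1≋0⇒⊥ : Prime p → ¬ 1ℤ ≋ 0ℤ ⟨ p ⟩
1≋0⇒⊥ pp c = contradiction (subst Prime (ℕ.∣1⇒≡1 (∣⇒∣ᵤ (≋0⇒∣ c))) pp) ¬prime[1]

module _ (b≥1 : b ℕ.≥ 1) .{{_ : NonZero w}} (ppd : PrimitivePrimeDivisor b w p) where

  base^w≋1 : (+ b) ^ w ≋ 1ℤ ⟨ p ⟩
  base^w≋1 = let to , _ = ∣∸1⇔≋1 b≥1 w in to (divides ppd)

  base-cancel : ∀ {x} k → x * (+ b) ^ k ≋ 0ℤ ⟨ p ⟩ → x ≋ 0ℤ ⟨ p ⟩
  base-cancel k = ≋-cancel-unit (^-≋-inverse base^w≋1 k)

  -- Cancelling b^i leaves b^d congruent to 1, which primitivity forbids for 1 ≤ d < w.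
  base^≋⇒≥ : ∀ i d → 1 ℕ.≤ d → (+ b) ^ (i ℕ.+ d) ≋ (+ b) ^ i ⟨ p ⟩ → w ℕ.≤ d
  base^≋⇒≥ i d 1≤d c = ℕ.≮⇒≥ λ d<w → minimal ppd d 1≤d d<w (let _ , from = ∣∸1⇔≋1 b≥1 d in from b^d≋1)
    where
    lemma : ∀ x y → (x - 1ℤ) * y ≡ y * x - y
    lemma = solve-∀
    b^d≋1 : (+ b) ^ d ≋ 1ℤ ⟨ p ⟩
    b^d≋1 = ≋-intro (≋0⇒∣ (base-cancel i (∣⇒≋0 (subst (_ Signed.∣_)
      (sym (trans (lemma ((+ b) ^ d) ((+ b) ^ i)) (cong (_- (+ b) ^ i) (sym (ℤ.^-distribˡ-+-* (+ b) i d)))))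
      (_≋_⟨_⟩.difference c)))))

  -- 0, b⁰, …, b^(w-1) are distinct residues.
  order<prime : w ℕ.< p
  order<prime = ℕ.≰⇒> λ p≤w → collide (Fin.pigeonhole (ℕ.s≤s p≤w) residueOf)
    where
    instance
      _ = prime⇒nonZero (isPrime ppd)
    residueOf : Fin (suc w) → Fin p
    residueOf Fin.zero    = 0 mod p
    residueOf (Fin.suc i) = (b ℕ.^ toℕ i) mod p

    mod⇒≋ : ∀ {i j} → i mod p ≡ j mod p → + i ≋ + j ⟨ p ⟩
    mod⇒≋ {i} {j} eq = %⇒≋ (trans (sym (toℕ-mod i)) (trans (cong toℕ eq) (toℕ-mod j)))
      where
      toℕ-mod : ∀ k → toℕ (k mod p) ≡ k ℕ.% p
      toℕ-mod k = Fin.toℕ-fromℕ< (ℕ.m%n<n k p)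

    collide : ¬ ∃₂ λ i j → i Fin.< j × residueOf i ≡ residueOf j
    collide (Fin.zero , Fin.suc j , _ , eq) = 1≋0⇒⊥ (isPrime ppd)
      (base-cancel (toℕ j) (≋-trans (≋-reflexive (trans (ℤ.*-identityˡ _) (sym (pos-^ b (toℕ j))))) (≋-sym (mod⇒≋ eq))))
    collide (Fin.suc i , Fin.suc j , ℕ.s<s i<j , eq) =
      ℕ.<⇒≱ (ℕ.≤-<-trans (ℕ.m∸n≤m (toℕ j) (toℕ i)) (Fin.toℕ<n j))
        (base^≋⇒≥ (toℕ i) (toℕ j ℕ.∸ toℕ i) (ℕ.m<n⇒0<n∸m i<j)
          (subst₂ (λ x y → x ≋ y ⟨ p ⟩)
            (trans (pos-^ b (toℕ j)) (cong ((+ b) ^_) (sym (ℕ.m+[n∸m]≡n (ℕ.<⇒≤ i<j)))))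
            (pos-^ b (toℕ i)) (≋-sym (mod⇒≋ eq))))

-- Absolute values, inequalities and distances between powers.

-∣i∣≡i : ∀ {i} → i ≤ 0ℤ → - (+ ∣ i ∣) ≡ i
-∣i∣≡i {+ zero}   _        = refl
-∣i∣≡i {+ suc n}  (+≤+ ())
-∣i∣≡i { -[1+ n ]} _       = refl

i≤+∣i∣ : ∀ i → i ≤ + ∣ i ∣
i≤+∣i∣ (+ n)    = ℤ.≤-refl
i≤+∣i∣ -[1+ n ] = ℤ.-≤+

∣i∣≤n⇒bounds : ∀ i {n} → ∣ i ∣ ℕ.≤ n → - (+ n) ≤ i × i ≤ + n
∣i∣≤n⇒bounds (+ m)    m≤n = ℤ.neg-≤-pos , +≤+ m≤n
∣i∣≤n⇒bounds -[1+ m ] m<n = ℤ.neg-mono-≤ (+≤+ m<n) , ℤ.-≤+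

-- Linear arithmetic by certificate: n - m is the sum of two nonnegative slacks, an identity which a
-- ring solver can check.
≤-combine : ∀ {i j k l m n} → i ≤ j → k ≤ l → (j - i) + (l - k) ≡ n - m → m ≤ n
≤-combine i≤j k≤l eq = ℤ.0≤i-j⇒j≤i (subst (0ℤ ≤_) eq (ℤ.+-mono-≤ (ℤ.i≤j⇒0≤j-i i≤j) (ℤ.i≤j⇒0≤j-i k≤l)))

n<b^n : ∀ {b} → 2 ℕ.≤ b → ∀ n → n ℕ.< b ℕ.^ n
n<b^n b≥2 zero    = ℕ.s≤s ℕ.z≤n
n<b^n {b} b≥2 (suc n) = begin
  suc (suc n)             ≤⟨ ℕ.+-mono-≤ (ℕ.≤-trans (ℕ.s≤s ℕ.z≤n) (n<b^n b≥2 n)) (n<b^n b≥2 n) ⟩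
  b ℕ.^ n ℕ.+ b ℕ.^ n     ≡⟨ cong (b ℕ.^ n ℕ.+_) (sym (ℕ.+-identityʳ _)) ⟩
  2 ℕ.* b ℕ.^ n           ≤⟨ ℕ.*-monoˡ-≤ (b ℕ.^ n) b≥2 ⟩
  b ℕ.* b ℕ.^ n           ∎
  where open ℕ.≤-Reasoning

-- For i ≤ j the difference of the two products is at least h b^i ≥ 3h > 2P. For i > j, the ratio
-- (a + h) / a ≤ 3/2 is too small to make up for a factor b ≥ 3.
powers-apart : ∀ {b P h a i j} → 3 ℕ.≤ b → 1 ℕ.≤ h → P ℕ.≤ h → h ℕ.+ h ℕ.≤ a → 1 ℕ.≤ i →
  (a ℕ.+ h) ℕ.* b ℕ.^ j ℕ.≤ a ℕ.* b ℕ.^ i ℕ.+ (P ℕ.+ P) →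
  a ℕ.* b ℕ.^ i ℕ.≤ (a ℕ.+ h) ℕ.* b ℕ.^ j ℕ.+ (P ℕ.+ P) → ⊥
powers-apart {b} {P} {h} {a} {i} {j} b≥3 h≥1 P≤h 2h≤a i≥1 upper lower with ℕ.≤-<-connex i j
... | inj₁ i≤j = ℕ.<⇒≱ (ℕ.m<m+n (a ℕ.* b ℕ.^ i ℕ.+ (h ℕ.+ h)) h≥1) (begin
  a ℕ.* b ℕ.^ i ℕ.+ (h ℕ.+ h) ℕ.+ h         ≡⟨ lemma a h (b ℕ.^ i) ⟩
  a ℕ.* b ℕ.^ i ℕ.+ h ℕ.* 3                 ≤⟨ ℕ.+-monoʳ-≤ (a ℕ.* b ℕ.^ i) (ℕ.*-monoʳ-≤ h (ℕ.≤-trans b≥3 b≤b^i)) ⟩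
  a ℕ.* b ℕ.^ i ℕ.+ h ℕ.* b ℕ.^ i           ≡⟨ ℕ.*-distribʳ-+ (b ℕ.^ i) a h ⟨
  (a ℕ.+ h) ℕ.* b ℕ.^ i                     ≤⟨ ℕ.*-monoʳ-≤ (a ℕ.+ h) (ℕ.^-monoʳ-≤ b i≤j) ⟩
  (a ℕ.+ h) ℕ.* b ℕ.^ j                     ≤⟨ upper ⟩
  a ℕ.* b ℕ.^ i ℕ.+ (P ℕ.+ P)               ≤⟨ ℕ.+-monoʳ-≤ (a ℕ.* b ℕ.^ i) (ℕ.+-mono-≤ P≤h P≤h) ⟩
  a ℕ.* b ℕ.^ i ℕ.+ (h ℕ.+ h)               ∎)
  where
  open ℕ.≤-Reasoning
  instance _ = ℕ.>-nonZero (ℕ.≤-trans (ℕ.s≤s ℕ.z≤n) b≥3)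
  lemma : ∀ a h c → a ℕ.* c ℕ.+ (h ℕ.+ h) ℕ.+ h ≡ a ℕ.* c ℕ.+ h ℕ.* 3
  lemma = ℕ-solve-∀
  b≤b^i : b ℕ.≤ b ℕ.^ i
  b≤b^i = subst (ℕ._≤ b ℕ.^ i) (ℕ.*-identityʳ b) (ℕ.^-monoʳ-≤ b i≥1)
... | inj₂ j<i = ℕ.<-irrefl refl (begin-strict
  a ℕ.* (3 ℕ.* e)                           ≤⟨ ℕ.*-monoʳ-≤ a (ℕ.*-monoˡ-≤ e b≥3) ⟩
  a ℕ.* b ℕ.^ suc j                         ≤⟨ ℕ.*-monoʳ-≤ a (ℕ.^-monoʳ-≤ b j<i) ⟩
  a ℕ.* b ℕ.^ i                             ≤⟨ lower ⟩
  (a ℕ.+ h) ℕ.* e ℕ.+ (P ℕ.+ P)             ≤⟨ ℕ.+-monoʳ-≤ ((a ℕ.+ h) ℕ.* e) (ℕ.+-mono-≤ P≤h P≤h) ⟩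
  (a ℕ.+ h) ℕ.* e ℕ.+ (h ℕ.+ h)             <⟨ ℕ.+-mono-<-≤ a+h<2a 2h≤ae ⟩
  (a ℕ.+ a) ℕ.* e ℕ.+ a ℕ.* e               ≡⟨ lemma a e ⟩
  a ℕ.* (3 ℕ.* e)                           ∎)
  where
  open ℕ.≤-Reasoning
  e = b ℕ.^ j
  instance
    _ = ℕ.>-nonZero (ℕ.≤-trans (ℕ.s≤s ℕ.z≤n) b≥3)
    _ = ℕ.m^n≢0 b j
  lemma : ∀ a e → (a ℕ.+ a) ℕ.* e ℕ.+ a ℕ.* e ≡ a ℕ.* (3 ℕ.* e)
  lemma = ℕ-solve-∀
  a+h<2a : (a ℕ.+ h) ℕ.* e ℕ.< (a ℕ.+ a) ℕ.* e
  a+h<2a = ℕ.*-monoˡ-< e (ℕ.+-monoʳ-< a (ℕ.<-≤-trans (ℕ.m<m+n h h≥1) 2h≤a))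
  2h≤ae : h ℕ.+ h ℕ.≤ a ℕ.* e
  2h≤ae = ℕ.≤-trans 2h≤a (ℕ.m≤m*n a e)

-- Sorting three distinct numbers.

insert-distinct : ∀ {R : ℕ → Set} → (∀ {x y z} → x ℕ.< y → y ℕ.< z → R x → R y → R z → ⊥) →
  ∀ {x y z} → x ℕ.< y → R x → R y → R z → x ≢ z → y ≢ z → ⊥
insert-distinct sorted {x} {y} {z} x<y rx ry rz x≢z y≢z with ℕ.<-cmp x z | ℕ.<-cmp y z
... | tri≈ _ x≡z _ | _            = x≢z x≡z
... | tri> _ _ z<x | _            = sorted z<x x<y rz rx ry
... | tri< _ _ _   | tri≈ _ y≡z _ = y≢z y≡z
... | tri< _ _ _   | tri< y<z _ _ = sorted x<y y<z rx ry rz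
... | tri< x<z _ _ | tri> _ _ z<y = sorted x<z z<y rx rz ry

-- Lets a contradiction proved for increasing triples apply to exceptional t found in three classes,
-- whose order is unknown.
three-distinct : ∀ {R : ℕ → Set} → (∀ {x y z} → x ℕ.< y → y ℕ.< z → R x → R y → R z → ⊥) →
  ∀ {x y z} → x ≢ y → y ≢ z → x ≢ z → R x → R y → R z → ⊥
three-distinct {R} sorted {x} {y} {z} x≢y y≢z x≢z rx ry rz with ℕ.<-cmp x y
... | tri≈ _ x≡y _ = x≢y x≡y
... | tri< x<y _ _ = insert-distinct sorted x<y rx ry rz x≢z y≢z
... | tri> _ _ y<x = insert-distinct sorted y<x ry rx rz y≢z x≢z

-- Exceptional pairs (t, n).

module Exceptions (b : ℕ) (b≥3 : 3 ℕ.≤ b) (α β : ℤ) (P : ℕ) where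

  B = + b

  leading : ℕ → ℤ
  leading t = + t * B ^ t + α

  term : ℕ → ℕ → ℤ
  term t n = leading t * B ^ n + β

  -- The obstruction to compositeness: the size hypothesis on t holds, yet the value at n lies in
  -- [-P, P], so a prime up to P dividing it need not be a proper divisor.
  record Exceptional (t n : ℕ) : Set where
    field
      initial  : + P ≤ leading t * B + β
      positive : 1 ℕ.≤ n
      lower    : - (+ P) ≤ term t n
      upper    : term t n ≤ + P

  open Exceptional

  instance
    b≢0 : NonZero b
    b≢0 = ℕ.>-nonZero (ℕ.≤-trans (ℕ.s≤s ℕ.z≤n) b≥3)

  growth : ℕ → ℕ
  growth t = t ℕ.* b ℕ.^ t

  pos-growth : ∀ t → + growth t ≡ + t * B ^ t
  pos-growth t = trans (ℤ.pos-* t (b ℕ.^ t)) (cong (_*_ (+ t)) (pos-^ b t))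

  B≤B^n : ∀ {n} → 1 ℕ.≤ n → B ≤ B ^ n
  B≤B^n {n} n≥1 = subst (B ≤_) (pos-^ b n)
    (+≤+ (subst (ℕ._≤ b ℕ.^ n) (ℕ.*-identityʳ b) (ℕ.^-monoʳ-≤ b n≥1)))

  initial≤term : ∀ t {n} → 0ℤ ≤ leading t → 1 ℕ.≤ n → leading t * B + β ≤ term t n
  initial≤term t 0≤A n≥1 =
    ℤ.+-monoˡ-≤ β (ℤ.*-monoˡ-≤-nonNeg (leading t) {{ℤ.nonNegative 0≤A}} (B≤B^n n≥1))

  -- The extreme case is t = s + 1, where t b^t = b (s b^s + b^s). The summand 1 keeps the growth
  -- strict at s = 0.
  growth-step : ∀ {s t} → s ℕ.< t → b ℕ.* (growth s ℕ.+ 1) ℕ.≤ growth t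
  growth-step {s} {t} s<t = begin
    b ℕ.* (growth s ℕ.+ 1)                  ≤⟨ ℕ.*-monoʳ-≤ b (ℕ.+-monoʳ-≤ (growth s) (ℕ.m^n>0 b s)) ⟩
    b ℕ.* (s ℕ.* b ℕ.^ s ℕ.+ b ℕ.^ s)       ≡⟨ lemma b s (b ℕ.^ s) ⟩
    suc s ℕ.* b ℕ.^ suc s                   ≤⟨ ℕ.*-mono-≤ s<t (ℕ.^-monoʳ-≤ b s<t) ⟩
    growth t                                ∎
    where
    open ℕ.≤-Reasoning
    lemma : ∀ b s c → b ℕ.* (s ℕ.* c ℕ.+ c) ≡ (1 ℕ.+ s) ℕ.* (b ℕ.* c)
    lemma = ℕ-solve-∀

  growth-< : ∀ {s t} → s ℕ.< t → growth s ℕ.< growth t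
  growth-< {s} {t} s<t = ℕ.<-≤-trans (subst (ℕ._≤ b ℕ.* (growth s ℕ.+ 1)) (ℕ.+-comm (growth s) 1)
    (ℕ.m≤n*m (growth s ℕ.+ 1) b)) (growth-step s<t)

  t≤growth : ∀ t → t ℕ.≤ growth t
  t≤growth t = ℕ.m≤m*n t (b ℕ.^ t) {{ℕ.m^n≢0 b t}}

  leading-< : ∀ {s t} → s ℕ.< t → leading s ℤ.< leading t
  leading-< {s} {t} s<t = ℤ.+-monoˡ-< α (subst₂ ℤ._<_ (pos-growth s) (pos-growth t) (ℤ.+<+ (growth-< s<t)))

  -- Were the leading coefficient at t nonnegative, its value at exponent 1 would be at most
  -- `term t n`, hence at most P and at most the value for s, although the leading coefficients
  -- strictly increase.
  leading-negative : ∀ {s t n} → s ℕ.< t → + P ≤ leading s * B + β → Exceptional t n → leading t ℤ.< 0ℤ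
  leading-negative {s} {t} s<t P≤ e = ℤ.≰⇒> λ 0≤A →
    ℤ.<⇒≱ (leading-< s<t) (ℤ.*-cancelʳ-≤-pos (leading t) (leading s) B {{ℤ.positive (ℤ.+<+ (ℕ.>-nonZero⁻¹ b))}}
      (≤-combine (ℤ.≤-trans (initial≤term t 0≤A (positive e)) (upper e)) P≤
        (lemma (leading t * B) (leading s * B) β (+ P))))
    where
    lemma : ∀ x y β p → (p - (x + β)) + (y + β - p) ≡ y - x
    lemma = solve-∀

  no-three-exceptional : ∀ {t₁ t₂ t₃ n₁ n₂ n₃} → t₃ ℕ.< t₂ → t₂ ℕ.< t₁ →
    + growth t₂ ≋ + growth t₃ ⟨ P ⟩ →
    Exceptional t₁ n₁ → Exceptional t₂ n₂ → Exceptional t₃ n₃ → ⊥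
  no-three-exceptional {t₁} {t₂} {t₃} {n₁} {n₂} {n₃} t₃<t₂ t₂<t₁ c e₁ e₂ e₃ =
    -- Here a and a + h are the negated leading coefficients at t₂ and t₃. P divides the positive
    -- number h, so P ≤ h; and 2h ≤ a because three times `growth t₂` is at most `growth t₁`, which
    -- is at most -α.
    powers-apart {b} {P} {h} {a} {n₂} {n₃} b≥3 (ℕ.m<n⇒0<n∸m (growth-< t₃<t₂)) P≤h 2h≤a (positive e₂)
      (window e₂ e₃ -a≡leading₂ -[a+h]≡leading₃)
      (window e₃ e₂ -[a+h]≡leading₃ -a≡leading₂)
    where
    h = growth t₂ ℕ.∸ growth t₃
    a = ∣ leading t₂ ∣

    leading₁≤0 : leading t₁ ≤ 0ℤ
    leading₁≤0 = ℤ.<⇒≤ (leading-negative {t₃} {t₁} (ℕ.<-trans t₃<t₂ t₂<t₁) (initial e₃) e₁)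

    -a≡leading₂ : - (+ a) ≡ leading t₂
    -a≡leading₂ = -∣i∣≡i (ℤ.≤-trans (ℤ.<⇒≤ (leading-< t₂<t₁)) leading₁≤0)

    -[a+h]≡leading₃ : - (+ (a ℕ.+ h)) ≡ leading t₃
    -[a+h]≡leading₃ = trans (cong (-_) (ℤ.pos-+ a h))
      (trans (ℤ.neg-distrib-+ (+ a) (+ h))
      (trans (cong₂ (λ x y → x - y) -a≡leading₂
               (trans (pos-∸ (ℕ.<⇒≤ (growth-< t₃<t₂))) (cong₂ _-_ (pos-growth t₂) (pos-growth t₃))))
             (lemma (+ t₂ * B ^ t₂) (+ t₃ * B ^ t₃) α)))
      where
      lemma : ∀ x y α → x + α - (x - y) ≡ y + α
      lemma = solve-∀

    P≤h : P ℕ.≤ h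
    P≤h = ℕ.∣⇒≤ {{ℕ.>-nonZero (ℕ.m<n⇒0<n∸m (growth-< t₃<t₂))}}
      (subst (P ℕ.∣_) (sym (cong ∣_∣ (pos-∸ (ℕ.<⇒≤ (growth-< t₃<t₂))))) (toMod c))

    2h+growth₂≤growth₁ : (h ℕ.+ h) ℕ.+ growth t₂ ℕ.≤ growth t₁
    2h+growth₂≤growth₁ = begin
      (h ℕ.+ h) ℕ.+ growth t₂                      ≤⟨ ℕ.+-monoˡ-≤ (growth t₂) (ℕ.+-mono-≤ h≤growth₂ h≤growth₂) ⟩
      (growth t₂ ℕ.+ growth t₂) ℕ.+ growth t₂      ≡⟨ lemma (growth t₂) ⟩
      3 ℕ.* growth t₂                              ≤⟨ ℕ.*-mono-≤ b≥3 (ℕ.m≤m+n (growth t₂) 1) ⟩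
      b ℕ.* (growth t₂ ℕ.+ 1)                      ≤⟨ growth-step t₂<t₁ ⟩
      growth t₁                                    ∎
      where
      open ℕ.≤-Reasoning
      lemma : ∀ g → (g ℕ.+ g) ℕ.+ g ≡ 3 ℕ.* g
      lemma = ℕ-solve-∀
      h≤growth₂ : h ℕ.≤ growth t₂
      h≤growth₂ = ℕ.m∸n≤m (growth t₂) (growth t₃)

    2h≤a : h ℕ.+ h ℕ.≤ a
    2h≤a = ℤ.drop‿+≤+ (≤-combine leading₁≤0 (+≤+ 2h+growth₂≤growth₁)
      (trans (cong₂ (λ x y → 0ℤ - leading t₁ + (x - y)) (pos-growth t₁)
                (trans (ℤ.pos-+ (h ℕ.+ h) (growth t₂)) (cong (_+_ (+ (h ℕ.+ h))) (pos-growth t₂))))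
      (trans (lemma (+ t₁ * B ^ t₁) (+ t₂ * B ^ t₂) α (+ (h ℕ.+ h)))
      (cong (_- + (h ℕ.+ h)) (trans (cong (-_) (sym -a≡leading₂)) (ℤ.neg-involutive (+ a)))))))
      where
      lemma : ∀ x y α h → 0ℤ - (x + α) + (x - (h + y)) ≡ - (y + α) - h
      lemma = solve-∀

    -- Two values in [-P, P] differ by at most 2P, and β cancels in their difference.
    window : ∀ {s t m n x y} → Exceptional s m → Exceptional t n →
      - (+ x) ≡ leading s → - (+ y) ≡ leading t → y ℕ.* b ℕ.^ n ℕ.≤ x ℕ.* b ℕ.^ m ℕ.+ (P ℕ.+ P)
    window {s} {t} {m} {n} {x} {y} e e′ eq eq′ = ℤ.drop‿+≤+ (≤-combine (upper e) (lower e′)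
      (trans (cong₂ (λ u v → + P - (u * B ^ m + β) + (v * B ^ n + β - - (+ P))) (sym eq) (sym eq′))
      (trans (lemma (+ x) (+ y) (B ^ m) (B ^ n) β (+ P))
      (cong₂ _-_
        (sym (trans (ℤ.pos-+ (x ℕ.* b ℕ.^ m) (P ℕ.+ P)) (cong₂ _+_ (pos x m) (ℤ.pos-+ P P))))
        (sym (pos y n))))))
      where
      pos : ∀ x m → + (x ℕ.* b ℕ.^ m) ≡ + x * B ^ m
      pos x m = trans (ℤ.pos-* x (b ℕ.^ m)) (cong (_*_ (+ x)) (pos-^ b m))
      lemma : ∀ x y u v β p → p - (- x * u + β) + (- y * v + β - - p) ≡ (x * u + (p + p)) - y * v
      lemma = solve-∀

  exceptional? : ∀ t n → Dec (Exceptional t n)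
  exceptional? t n = map′ (λ (x , y , z , w) → record { initial = x ; positive = y ; lower = z ; upper = w })
    (λ e → initial e , positive e , lower e , upper e)
    ((+ P ℤ.≤? leading t * B + β) ×-dec (1 ℕ.≤? n) ×-dec (- (+ P) ℤ.≤? term t n) ×-dec (term t n ℤ.≤? + P))

  -- An exceptional t satisfies t ≤ t b^t ≤ |α| + |β| + P. The extra 2 makes the bound strict and
  -- admits the exponent 1.
  bound : ℕ
  bound = 2 ℕ.+ (∣ α ∣ ℕ.+ ∣ β ∣ ℕ.+ P)

  private
    P+β≤ : + P + β ≤ + (∣ β ∣ ℕ.+ P)
    P+β≤ = subst (+ P + β ≤_) (trans (sym (ℤ.pos-+ P ∣ β ∣)) (cong +_ (ℕ.+-comm P ∣ β ∣))) (ℤ.+-monoʳ-≤ (+ P) (i≤+∣i∣ β))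

    -i≤∣i∣ : ∀ i → - i ≤ + ∣ i ∣
    -i≤∣i∣ i = subst (λ k → - i ≤ + k) (ℤ.∣-i∣≡∣i∣ i) (i≤+∣i∣ (- i))

    leading≤⇒<bound : ∀ t → leading t ≤ + (∣ β ∣ ℕ.+ P) → t ℕ.< bound
    leading≤⇒<bound t A≤ = ℕ.s≤s (ℕ.m≤n⇒m≤1+n (ℕ.≤-trans (t≤growth t) (ℤ.drop‿+≤+
      (≤-combine A≤ (-i≤∣i∣ α)
        (trans (lemma (+ (∣ β ∣ ℕ.+ P)) (+ t * B ^ t) α (+ ∣ α ∣))
          (cong₂ _-_ sum (sym (pos-growth t))))))))
      where
      lemma : ∀ p u α a → p - (u + α) + (a - - α) ≡ (a + p) - u
      lemma = solve-∀
      sum : + ∣ α ∣ + + (∣ β ∣ ℕ.+ P) ≡ + (∣ α ∣ ℕ.+ ∣ β ∣ ℕ.+ P)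
      sum = trans (sym (ℤ.pos-+ ∣ α ∣ (∣ β ∣ ℕ.+ P))) (cong +_ (sym (ℕ.+-assoc ∣ α ∣ ∣ β ∣ P)))

  -- The exponent may have to change: for leading coefficient 0 every positive n is exceptional. If
  -- the coefficient is nonnegative, the value at exponent 1 is squeezed to P, so 1 serves; if it is
  -- negative, b^n ≤ |β| + P bounds n itself.
  exceptional-bounded : ∀ {t n} → Exceptional t n → t ℕ.< bound × ∃[ n′ ] n′ ℕ.< bound × Exceptional t n′
  exceptional-bounded {t} {n} e with 0ℤ ℤ.≤? leading t
  ... | yes 0≤A = leading≤⇒<bound t (ℤ.≤-trans A≤A*B A*B≤) , 1 , ℕ.s≤s (ℕ.s≤s ℕ.z≤n) , record
    { initial  = initial e
    ; positive = ℕ.≤-refl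
    ; lower    = ℤ.≤-trans ℤ.neg-≤-pos (subst (+ P ≤_) term₁ (initial e))
    ; upper    = subst (_≤ + P) term₁ initial≤P
    }
    where
    term₁ : leading t * B + β ≡ term t 1
    term₁ = cong (λ x → leading t * x + β) (sym (ℤ.^-identityʳ B))
    initial≤P : leading t * B + β ≤ + P
    initial≤P = ℤ.≤-trans (initial≤term t 0≤A (positive e)) (upper e)
    A≤A*B : leading t ≤ leading t * B
    A≤A*B = subst (_≤ leading t * B) (ℤ.*-identityʳ (leading t))
      (ℤ.*-monoˡ-≤-nonNeg (leading t) {{ℤ.nonNegative 0≤A}} (+≤+ (ℕ.>-nonZero⁻¹ b)))
    A*B≤ : leading t * B ≤ + (∣ β ∣ ℕ.+ P)
    A*B≤ = ≤-combine initial≤P (-i≤∣i∣ β) (trans (lemma (leading t * B) β (+ P) (+ ∣ β ∣))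
      (cong (_- leading t * B) (sym (ℤ.pos-+ ∣ β ∣ P))))
      where
      lemma : ∀ x β p c → p - (x + β) + (c - - β) ≡ c + p - x
      lemma = solve-∀
  ... | no 0≰A = leading≤⇒<bound t (ℤ.≤-trans A≤0 (+≤+ ℕ.z≤n)) , n , n<bound , e
    where
    A≤0 : leading t ≤ 0ℤ
    A≤0 = ℤ.<⇒≤ (ℤ.≰⇒> 0≰A)
    instance
      ∣A∣≢0 : NonZero ∣ leading t ∣
      ∣A∣≢0 = ℕ.≢-nonZero λ ∣A∣≡0 → 0≰A (ℤ.≤-reflexive (sym (ℤ.∣i∣≡0⇒i≡0 ∣A∣≡0)))
    ∣A∣b^n≤ : ∣ leading t ∣ ℕ.* b ℕ.^ n ℕ.≤ ∣ β ∣ ℕ.+ P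
    ∣A∣b^n≤ = ℤ.drop‿+≤+ (≤-combine (lower e) P+β≤
      (trans (cong (λ x → x * B ^ n + β - - (+ P) + (+ (∣ β ∣ ℕ.+ P) - (+ P + β))) (sym (-∣i∣≡i A≤0)))
      (trans (lemma (+ ∣ leading t ∣) (B ^ n) β (+ P) (+ (∣ β ∣ ℕ.+ P)))
        (cong (_-_ (+ (∣ β ∣ ℕ.+ P)))
          (sym (trans (ℤ.pos-* ∣ leading t ∣ (b ℕ.^ n)) (cong (_*_ (+ ∣ leading t ∣)) (pos-^ b n))))))))
      where
      lemma : ∀ a c β p d → - a * c + β - - p + (d - (p + β)) ≡ d - a * c
      lemma = solve-∀
    n<bound : n ℕ.< bound
    n<bound = begin-strict
      n                                     <⟨ n<b^n (ℕ.≤-trans (ℕ.n≤1+n 2) b≥3) n ⟩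
      b ℕ.^ n                               ≤⟨ ℕ.m≤n*m (b ℕ.^ n) ∣ leading t ∣ ⟩
      ∣ leading t ∣ ℕ.* b ℕ.^ n             ≤⟨ ∣A∣b^n≤ ⟩
      ∣ β ∣ ℕ.+ P                           ≤⟨ ℕ.m≤n+m (∣ β ∣ ℕ.+ P) (2 ℕ.+ ∣ α ∣) ⟩
      2 ℕ.+ ∣ α ∣ ℕ.+ (∣ β ∣ ℕ.+ P)         ≡⟨ ℕ.+-assoc (2 ℕ.+ ∣ α ∣) ∣ β ∣ P ⟨
      bound                                 ∎
      where open ℕ.≤-Reasoning

  -- The bounds on t and n make it decidable whether a class is spoiled, so the refutation of three
  -- spoiled classes yields an actual unspoiled one.
  avoid-exceptional : ∀ (Q : Fin 3 → ℕ → Set) → (∀ i t → Dec (Q i t)) →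
    (∀ {i j t} → Q i t → Q j t → i ≡ j) →
    (∀ {i j s t} → Q i s → Q j t → + growth s ≋ + growth t ⟨ P ⟩) →
    ∃[ i ] (∀ t n → Q i t → ¬ Exceptional t n)
  avoid-exceptional Q Q? disjoint congruent with Fin.¬∀⟶∃¬ 3 Spoiled spoiled? not-all
    where
    Spoiled : Fin 3 → Set
    Spoiled i = ∃[ t ] t ℕ.< bound × Q i t × ∃[ n ] n ℕ.< bound × Exceptional t n
    spoiled? : ∀ i → Dec (Spoiled i)
    spoiled? i = ℕ.anyUpTo? (λ t → Q? i t ×-dec ℕ.anyUpTo? (exceptional? t) bound) bound

    Candidate : ℕ → Set
    Candidate t = (∃[ i ] Q i t) × ∃[ n ] Exceptional t n

    not-all : ¬ (∀ i → Spoiled i)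
    not-all spoiled with spoiled (# 0) | spoiled (# 1) | spoiled (# 2)
    ... | t₀ , _ , q₀ , n₀ , _ , e₀ | t₁ , _ , q₁ , n₁ , _ , e₁ | t₂ , _ , q₂ , n₂ , _ , e₂ =
      three-distinct {Candidate}
        (λ x<y y<z ((_ , qx) , _ , ex) ((_ , qy) , _ , ey) (_ , _ , ez) →
          no-three-exceptional x<y y<z (congruent qy qx) ez ey ex)
        (λ { refl → contradiction (disjoint q₀ q₁) λ () })
        (λ { refl → contradiction (disjoint q₁ q₂) λ () })
        (λ { refl → contradiction (disjoint q₀ q₂) λ () })
        ((_ , q₀) , _ , e₀) ((_ , q₁) , _ , e₁) ((_ , q₂) , _ , e₂)
  ... | i , unspoiled = i , λ t n q e →
    let t<bound , n′ , n′<bound , e′ = exceptional-bounded e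
    in unspoiled (t , t<bound , q , n′ , n′<bound , e′)

-- Congruences paired with their primes.

modulus-nonZero : ∀ c → NonZero (modulus c)
modulus-nonZero record { modulus = m ; modulus≢0 = m≢0 } = recompute (ℕ.nonZero? m) m≢0

-- Keeps each congruence with its own prime, so that both can be filtered as a single list.
record Entry (b : ℕ) : Set where
  field
    congruence  : Congruence
    prime       : ℕ
    isPrimitive : PrimitivePrimeDivisor b (modulus congruence) prime

open Entry

entries : ∀ {b} cs {ps} → Pointwise (PrimitivePrimeDivisor b) (map modulus cs) ps →
  ∃[ es ] map (congruence {b}) es ≡ cs × map prime es ≡ ps
entries []       []           = [] , refl , refl
entries (c ∷ cs) (ppd ∷ ppds) with es , refl , refl ← entries cs ppds =
  record { congruence = c ; prime = _ ; isPrimitive = ppd } ∷ es , refl , refl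

least-residue : ∀ x m .{{_ : NonZero m}} → + (x ℤ.%ℕ m) ≋ x ⟨ m ⟩
least-residue x m = ≋-sym (≋-witness (x ℤ./ℕ m) (ℤ.a≡a%ℕn+[a/ℕn]*n x m))

-- Solving for t modulo the primes.

module Solving (b : ℕ) (b≥3 : 3 ℕ.≤ b) (α β : ℤ) (P : ℕ) where

  open Exceptions b b≥3 α β P

  b≥1 : 1 ℕ.≤ b
  b≥1 = ℕ.≤-trans (ℕ.s≤s ℕ.z≤n) b≥3

  -- Two conditions on t, since it occurs as a factor, which matters modulo the prime, and as an
  -- exponent of b, which matters modulo the modulus.
  Solves : ℤ → Entry b → Set
  Solves s e = ∀ t n → + t ≋ s ⟨ modulus (congruence e) ⟩ → + t ≋ s ⟨ prime e ⟩ →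
    + n ≋ residue (congruence e) ⟨ modulus (congruence e) ⟩ → term t n ≋ 0ℤ ⟨ prime e ⟩

  solves-resp : ∀ {s s′} e → s′ ≋ s ⟨ modulus (congruence e) ⟩ → s′ ≋ s ⟨ prime e ⟩ → Solves s e → Solves s′ e
  solves-resp e c c′ sol t n d d′ = sol t n (≋-trans d c) (≋-trans d′ c′)

  term-cong : ∀ {p t n x y z} → + t ≋ x ⟨ p ⟩ → B ^ t ≋ y ⟨ p ⟩ → B ^ n ≋ z ⟨ p ⟩ →
    term t n ≋ (x * y + α) * z + β ⟨ p ⟩
  term-cong c d e = ≋-+ (≋-* (≋-+ (≋-* c d) (≋-refl {α})) e) (≋-refl {β})

  -- The class modulo L already determines b^t modulo the prime. What remains is linear in t with a
  -- unit coefficient, and coprimality allows its solution to be joined to the class modulo L.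
  solve-one : ∀ {L} e s → Coprime (prime e) L → modulus (congruence e) ℕ.∣ L →
    ∃[ s′ ] s′ ≋ s ⟨ L ⟩ × Solves s′ e
  solve-one {L} e s cop m∣L =
    let s′ , s′≋target , s′≋s = chinese cop target s in s′ , s′≋s , λ t n t≋ₘs′ t≋ₚs′ n≋ → ≋-trans
      (term-cong {n = n} {z = B ^ ν} (≋-trans t≋ₚs′ s′≋target)
        (^-≋-periodic b^μ≋1 t τ (≋-trans t≋ₘs′ (≋-trans (≋-weaken m∣L s′≋s) (≋-sym (least-residue s μ)))))
        (^-≋-periodic b^μ≋1 n ν (≋-trans n≋ (≋-sym (least-residue (residue (congruence e)) μ)))))
      (≋-trans (≋-reflexive (trans
          (lemma₁ c (B ^ ((τ ℕ.+ ν) ℕ.* ℕ.pred μ)) (B ^ τ) (B ^ ν) α β)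
          (cong (λ x → c * (x * B ^ ((τ ℕ.+ ν) ℕ.* ℕ.pred μ)) + (α * B ^ ν + β)) (sym (ℤ.^-distribˡ-+-* B τ ν)))))
        (≋-trans (≋-+ (≋-* (≋-refl {c}) (^-≋-inverse b^μ≋1 (τ ℕ.+ ν))) (≋-refl {α * B ^ ν + β}))
          (≋-reflexive (lemma₂ β α (B ^ ν)))))
    where
    μ τ ν : ℕ
    μ = modulus (congruence e)
    instance _ = modulus-nonZero (congruence e)
    τ = s ℤ.%ℕ μ
    ν = residue (congruence e) ℤ.%ℕ μ
    b^μ≋1 : B ^ μ ≋ 1ℤ ⟨ prime e ⟩
    b^μ≋1 = base^w≋1 b≥1 (isPrimitive e)
    c target : ℤ
    c = - β - α * B ^ ν
    -- The power of `B` is the inverse of b^(τ + ν) modulo the prime, because b^μ is 1 there.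
    target = c * B ^ ((τ ℕ.+ ν) ℕ.* ℕ.pred μ)
    lemma₁ : ∀ c i x y α β → (c * i * x + α) * y + β ≡ c * (x * y * i) + (α * y + β)
    lemma₁ = solve-∀
    lemma₂ : ∀ β α y → (- β - α * y) * 1ℤ + (α * y + β) ≡ 0ℤ
    lemma₂ = solve-∀

  Ready : ℕ → Entry b → Set
  Ready L e = Coprime (prime e) L × modulus (congruence e) ℕ.∣ L

  ready-* : ∀ {L n} e → Coprime (prime e) n → Ready L e → Ready (L ℕ.* n) e
  ready-* {n = n} e c′ (c , m∣L) = coprime-* c c′ , ℕ.∣-trans m∣L (ℕ.m∣m*n n)

  -- Each treated prime is multiplied into L, so later steps preserve its solution; pairwise
  -- coprimality keeps the remaining entries ready for the larger L.
  solve-all : ∀ {L} es s → AllPairs (Coprime on prime) es → All (Ready L) es →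
    ∃[ s′ ] s′ ≋ s ⟨ L ⟩ × All (Solves s′) es
  solve-all []       s _ _ = s , ≋-refl , []
  solve-all {L} (e ∷ es) s (cops ∷ pairwise) ((cop , m∣L) ∷ good) =
    let s₁ , s₁≋s , sol  = solve-one e s cop m∣L
        s₂ , s₂≋s₁ , sols = solve-all {L ℕ.* prime e} es s₁ pairwise
          (All.zipWith {P = λ e′ → Coprime (prime e) (prime e′)} {Q = Ready L} {R = Ready (L ℕ.* prime e)}
            (λ {e′} (c , r) → ready-* e′ (Coprimality.sym c) r) (cops , good))
        s₂≋s₁[L] = ≋-weaken (ℕ.m∣m*n (prime e)) s₂≋s₁
    in s₂ , ≋-trans s₂≋s₁[L] s₁≋s
       , solves-resp e (≋-weaken m∣L s₂≋s₁[L]) (≋-weaken (ℕ.n∣m*n L) s₂≋s₁) sol ∷ sols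

  -- Take a common exponent ν in the residue class. Subtracting the two vanishing terms removes α
  -- and β, and the unit b^ν cancels.
  solutions-growth : ∀ e {s s′ t t′} → Solves s e → Solves s′ e →
    + t ≋ s ⟨ modulus (congruence e) ⟩ → + t ≋ s ⟨ prime e ⟩ →
    + t′ ≋ s′ ⟨ modulus (congruence e) ⟩ → + t′ ≋ s′ ⟨ prime e ⟩ →
    + growth t ≋ + growth t′ ⟨ prime e ⟩
  solutions-growth e {t = t} {t′} sol sol′ c d c′ d′ =
    ≋-intro (≋0⇒∣ (base-cancel b≥1 {{modulus-nonZero (congruence e)}} (isPrimitive e) ν (≋-trans
      (≋-reflexive (trans (cong₂ (λ x y → (x - y) * B ^ ν) (pos-growth t) (pos-growth t′))
        (lemma (+ t * B ^ t) (+ t′ * B ^ t′) α (B ^ ν) β)))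
      (≋-+ (sol t ν c d ν≋) (≋-* (≋-refl { - 1ℤ}) (sol′ t′ ν c′ d′ ν≋))))))
    where
    μ ν : ℕ
    μ = modulus (congruence e)
    ν = (residue (congruence e) ℤ.%ℕ μ) {{modulus-nonZero (congruence e)}}
    ν≋ : + ν ≋ residue (congruence e) ⟨ μ ⟩
    ν≋ = least-residue (residue (congruence e)) μ {{modulus-nonZero (congruence e)}}
    lemma : ∀ x y α v β → (x - y) * v ≡ ((x + α) * v + β) + - 1ℤ * ((y + α) * v + β)
    lemma = solve-∀

-- Arithmetic of the prescribed moduli.

∣-lcmList : ∀ {n ns} → n ∈ ns → n ℕ.∣ lcmList ns
∣-lcmList {ns = n ∷ ns} (here refl)  = m∣lcm[m,n] n (lcmList ns)
∣-lcmList {ns = n ∷ ns} (there n∈ns) = ℕ.∣-trans (∣-lcmList n∈ns) (n∣lcm[m,n] n (lcmList ns))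

prescribed⇒shape : ∀ {q m} → m ∈ prescribedModuli q →
  ∃[ j ] ∃[ k ] ∃[ l ] (j ℕ.≤ q × k ℕ.< q × l ℕ.< 2 × m ≡ 2 ℕ.^ j ℕ.* 3 ℕ.^ suc k ℕ.* q ℕ.^ l)
prescribed⇒shape {q} m∈ with ∈-map⁻ _ m∈
... | (j , k , l) , jkl∈ , refl with ∈-cartesianProduct⁻ (upTo (suc q)) (cartesianProduct (applyUpTo suc q) (upTo 2)) jkl∈
... | j∈ , kl∈ with ∈-cartesianProduct⁻ (applyUpTo suc q) (upTo 2) kl∈
... | k∈ , l∈ with ∈-applyUpTo⁻ suc k∈
... | k′ , k′<q , refl = j , k′ , l , ℕ.s≤s⁻¹ (∈-upTo⁻ j∈) , k′<q , ∈-upTo⁻ l∈ , refl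

m^i∣m^j : ∀ m {i j} → i ℕ.≤ j → m ℕ.^ i ℕ.∣ m ℕ.^ j
m^i∣m^j m {i} {j} i≤j = ℕ.divides (m ℕ.^ (j ℕ.∸ i))
  (trans (cong (m ℕ.^_) (sym (ℕ.m∸n+n≡m i≤j))) (ℕ.^-distribˡ-+-* m (j ℕ.∸ i) i))

smooth : ℕ → ℕ
smooth q = 2 ℕ.^ q ℕ.* 3 ℕ.^ q

smooth∣ : ∀ {q j k} → j ℕ.≤ q → k ℕ.≤ q → 2 ℕ.^ j ℕ.* 3 ℕ.^ k ℕ.∣ smooth q
smooth∣ j≤q k≤q = ℕ.*-pres-∣ (m^i∣m^j 2 j≤q) (m^i∣m^j 3 k≤q)

-- Every modulus is a multiple of 3. This forces the primes above 3 and the order of b above 1.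
prescribed≥3 : ∀ {q m} .{{_ : NonZero q}} → m ∈ prescribedModuli q → 3 ℕ.≤ m
prescribed≥3 {q} m∈ with j , k , l , _ , _ , _ , refl ← prescribed⇒shape m∈ =
  ℕ.∣⇒≤ {{ℕ.m*n≢0 _ _ {{ℕ.m*n≢0 _ _ {{ℕ.m^n≢0 2 j}} {{ℕ.m^n≢0 3 (suc k)}}}} {{ℕ.m^n≢0 q l}}}}
    (ℕ.∣m⇒∣m*n (q ℕ.^ l) (ℕ.∣n⇒∣m*n (2 ℕ.^ j) (ℕ.m∣m*n (3 ℕ.^ k))))

prescribed∣ : ∀ {q m} → m ∈ prescribedModuli q → m ℕ.∣ smooth q ℕ.* q
prescribed∣ {q} m∈ with j , k , l , j≤q , k<q , l<2 , refl ← prescribed⇒shape m∈ =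
  ℕ.*-pres-∣ (smooth∣ j≤q k<q) (subst (q ℕ.^ l ℕ.∣_) (ℕ.*-identityʳ q) (m^i∣m^j q (ℕ.s≤s⁻¹ l<2)))

-- A modulus below q cannot be a multiple of q. Applied when q is itself the chosen prime, as the
-- order is then below q.
prescribed<⇒∣smooth : ∀ {q m} → m ∈ prescribedModuli q → m ℕ.< q → m ℕ.∣ smooth q
prescribed<⇒∣smooth {q} m∈ m<q with prescribed⇒shape m∈
... | j , k , 0 , j≤q , k<q , _ , refl = subst (ℕ._∣ smooth q) (sym (ℕ.*-identityʳ _)) (smooth∣ j≤q k<q)
... | j , k , 1 , _ , _ , _ , refl = contradiction m<q (ℕ.≤⇒≯ (ℕ.≤-trans (ℕ.≤-reflexive (sym (ℕ.*-identityʳ q)))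
  (ℕ.m≤n*m (q ℕ.* 1) _ {{ℕ.m*n≢0 _ _ {{ℕ.m^n≢0 2 j}} {{ℕ.m^n≢0 3 (suc k)}}}})))
... | j , k , suc (suc _) , _ , _ , ℕ.s≤s (ℕ.s≤s ()) , refl

-- Solving the whole system over a class modulo `L`.

module System (b : ℕ) (b≥3 : 3 ℕ.≤ b) (α β : ℤ) (q : ℕ) (prime-q : Prime q) (q≥5 : 5 ℕ.≤ q)
              (P : ℕ) (es : List (Entry b)) (unique : Unique (map prime es))
              (prescribed : ∀ {e} → e ∈ es → modulus (congruence e) ∈ prescribedModuli q) where

  open Exceptions b b≥3 α β P
  open Solving b b≥3 α β P

  instance
    q≢0 : NonZero q
    q≢0 = prime⇒nonZero prime-q

  -- The part of M fixed before any prime is treated: the smooth factor separates the three classes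
  -- and b - 1 governs the gcd.
  L : ℕ
  L = lcm (smooth q) (b ℕ.∸ 1)

  prime[3] : Prime 3
  prime[3] = from-yes (prime? 3)

  >3⇒coprime-smooth : ∀ {p} → Prime p → 3 ℕ.< p → Coprime p (smooth q)
  >3⇒coprime-smooth pp p>3 = coprime-*
    (coprime-^ (prime≢⇒coprime pp prime[2] λ { refl → contradiction p>3 (from-no (3 ℕ.<? 2)) }) q)
    (coprime-^ (prime≢⇒coprime pp prime[3] λ { refl → contradiction p>3 (from-no (3 ℕ.<? 3)) }) q)

  -- The prime exceeds the order, hence 3, so it divides neither 2^q nor 3^q; and since the order is
  -- not 1, it does not divide b - 1.
  coprime-L : ∀ e → 3 ℕ.≤ modulus (congruence e) → Coprime (prime e) L
  coprime-L e m≥3 (d∣p , d∣L) = coprime-* {prime e} {smooth q} {b ℕ.∸ 1}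
    (>3⇒coprime-smooth (isPrime (isPrimitive e))
      (ℕ.≤-<-trans m≥3 (order<prime b≥1 {{modulus-nonZero (congruence e)}} (isPrimitive e))))
    (prime∧∤⇒coprime (isPrime (isPrimitive e)) λ p∣b∸1 →
      minimal (isPrimitive e) 1 ℕ.≤-refl (ℕ.≤-trans (ℕ.s≤s (ℕ.s≤s ℕ.z≤n)) m≥3)
        (subst (λ x → prime e ℕ.∣ x ℕ.∸ 1) (sym (ℕ.^-identityʳ b)) p∣b∸1))
    (d∣p , ℕ.∣-trans d∣L (lcm-least {smooth q} (ℕ.m∣m*n (b ℕ.∸ 1)) (ℕ.n∣m*n (smooth q))))

  ready-q : ∀ {e} → e ∈ es → prime e ≡ q → Ready L e
  ready-q {e} e∈es p≡q = (λ {d} → coprime-L e (prescribed≥3 (prescribed e∈es)) {d})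
    , ℕ.∣-trans (prescribed<⇒∣smooth (prescribed e∈es)
        (subst (modulus (congruence e) ℕ.<_) p≡q (order<prime b≥1 {{modulus-nonZero (congruence e)}} (isPrimitive e))))
        (m∣lcm[m,n] (smooth q) (b ℕ.∸ 1))

  ready-≢q : ∀ {e} → e ∈ es → prime e ≢ q → Ready (L ℕ.* q) e
  ready-≢q {e} e∈es p≢q = coprime-* (coprime-L e (prescribed≥3 (prescribed e∈es)))
      (prime≢⇒coprime (isPrime (isPrimitive e)) prime-q p≢q)
    , ℕ.∣-trans (prescribed∣ (prescribed e∈es)) (ℕ.*-monoˡ-∣ q (m∣lcm[m,n] (smooth q) (b ℕ.∸ 1)))

  pairwise-coprime : AllPairs (Coprime on prime) es
  pairwise-coprime = AllPairs.map (λ {e} {e′} → prime≢⇒coprime (isPrime (isPrimitive e)) (isPrime (isPrimitive e′)))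
    (AllPairs.map⁻ unique)

  -- If q is one of the primes, its order is below q, so its exponent does not involve the residue modulo q,
  -- which can therefore be fixed first.
  solve-system : ∀ s → ∃[ T ] T ≋ s ⟨ L ⟩ × All (Solves T) es
  solve-system s =
    let s₁ , s₁≋s , sol₁  = solve-all {L} (filter q? es) s (AllPairs.filter⁺ q? pairwise-coprime)
          (All.map (λ (p≡q , e∈) → ready-q e∈ p≡q) q-entries)
        s₂ , s₂≋s₁ , sol₂ = solve-all {L ℕ.* q} (filter (¬? ∘ q?) es) s₁ (AllPairs.filter⁺ (¬? ∘ q?) pairwise-coprime)
          (All.map (λ (p≢q , e∈) → ready-≢q e∈ p≢q) (classify (¬? ∘ q?)))
        s₂≋s₁[L] = ≋-weaken (ℕ.m∣m*n q) s₂≋s₁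
    in s₂ , ≋-trans s₂≋s₁[L] s₁≋s , All.filter⁻ q?
         (All.zipWith {P = Solves s₁} {Q = λ e → prime e ≡ q × e ∈ es} {R = Solves s₂}
           (λ {e} (sol , p≡q , e∈) → solves-resp e
             (≋-weaken (proj₂ (ready-q e∈ p≡q)) s₂≋s₁[L])
             (≋-weaken (subst (ℕ._∣ L ℕ.* q) (sym p≡q) (ℕ.n∣m*n L)) s₂≋s₁) sol)
           (sol₁ , q-entries))
         sol₂
    where
    q? : ∀ e → Dec (prime e ≡ q)
    q? e = prime e ℕ.≟ q
    classify : ∀ {R : Entry b → Set} (R? : ∀ e → Dec (R e)) → All (λ e → R e × e ∈ es) (filter R? es)
    classify R? = All.zip (All.all-filter R? es , All.filter⁺ R? (All.tabulate id))
    q-entries : All (λ e → prime e ≡ q × e ∈ es) (filter q? es)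
    q-entries = classify q?

  -- Three units modulo `L` and the gcd condition.

  9∣L : 9 ℕ.∣ L
  9∣L = ℕ.∣-trans (ℕ.∣-trans (m^i∣m^j 3 (ℕ.≤-trans (from-yes (2 ℕ.≤? 5)) q≥5)) (ℕ.n∣m*n (2 ℕ.^ q)))
    (m∣lcm[m,n] (smooth q) (b ℕ.∸ 1))

  h : ℕ
  h = ℕ.quotient 9∣L

  L≡h*9 : L ≡ h ℕ.* 9
  L≡h*9 = ℕ._∣_.equality 9∣L

  L≢0 : NonZero L
  L≢0 = ℕ.≢-nonZero λ L≡0 → ℕ.≢-nonZero⁻¹ (smooth q ℕ.* (b ℕ.∸ 1))
    {{ℕ.m*n≢0 (smooth q) (b ℕ.∸ 1) {{ℕ.m*n≢0 _ _ {{ℕ.m^n≢0 2 q}} {{ℕ.m^n≢0 3 q}}}}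
      {{ℕ.>-nonZero (ℕ.m<n⇒0<n∸m (ℕ.≤-trans (ℕ.s≤s (ℕ.s≤s ℕ.z≤n)) b≥3))}}}}
    (trans (sym (gcd*lcm (smooth q) (b ℕ.∸ 1)))
      (trans (cong (ℕ.gcd (smooth q) (b ℕ.∸ 1) ℕ.*_) L≡0) (ℕ.*-zeroʳ (ℕ.gcd (smooth q) (b ℕ.∸ 1)))))

  -- Congruent to 1 modulo L / 3 with 9 ∣ L, hence units modulo L: (1 + 3hk)(1 - 3hk) = 1 - 9h²k².
  unit : Fin 3 → ℤ
  unit i = 1ℤ + + h * + 3 * + toℕ i

  unit⁻¹ : Fin 3 → ℤ
  unit⁻¹ i = 1ℤ - + h * + 3 * + toℕ i

  pos-L : + L ≡ + h * + 9
  pos-L = trans (cong +_ L≡h*9) (ℤ.pos-* h 9)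

  unit*unit⁻¹≋1 : ∀ i → unit i * unit⁻¹ i ≋ 1ℤ ⟨ L ⟩
  unit*unit⁻¹≋1 i = ≋-witness (- (+ h * (+ toℕ i * + toℕ i)))
    (trans (lemma (+ h) (+ toℕ i)) (cong (λ x → 1ℤ + - (+ h * (+ toℕ i * + toℕ i)) * x) (sym pos-L)))
    where
    lemma : ∀ h k → (1ℤ + h * + 3 * k) * (1ℤ - h * + 3 * k) ≡ 1ℤ + - (h * (k * k)) * (h * + 9)
    lemma = solve-∀

  -- The difference of two units is 3h (i - j), while `L` is 3h times 3; so 3 divides i - j, where i
  -- and j are below 3.
  unit-injective : ∀ {i j} → unit i ≋ unit j ⟨ L ⟩ → i ≡ j
  unit-injective {i} {j} (≋-intro d) = distinct-mod-3 i j
      (∣⇒∣ᵤ (Signed.*-cancelˡ-∣ (+ (h ℕ.* 3)) {+ 3} {+ toℕ i - + toℕ j} {{h*3≢0}}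
        (subst₂ Signed._∣_ (trans (cong +_ (trans L≡h*9 (sym (ℕ.*-assoc h 3 3)))) (ℤ.pos-* (h ℕ.* 3) 3))
          (trans (lemma (+ h * + 3) (+ toℕ i) (+ toℕ j)) (cong (_* (+ toℕ i - + toℕ j)) (sym (ℤ.pos-* h 3)))) d)))
    where
    distinct-mod-3 : ∀ (i j : Fin 3) → 3 ℕ.∣ ∣ + toℕ i - + toℕ j ∣ → i ≡ j
    distinct-mod-3 = from-yes (Fin.all? {n = 3} λ i → Fin.all? {n = 3} λ j → (3 ℕ.∣? ∣ + toℕ i - + toℕ j ∣) →-dec (i Fin.≟ j))
    h*3≢0 : NonZero (h ℕ.* 3)
    h*3≢0 = ℕ.m*n≢0 h 3 {{ℕ.m*n≢0⇒m≢0 h {{subst NonZero L≡h*9 L≢0}}}}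
    lemma : ∀ c i j → 1ℤ + c * i - (1ℤ + c * j) ≡ c * (i - j)
    lemma = solve-∀

  -- Powers of b are 1 modulo b - 1, so for t in this class t b^t + α + β is congruent there to
  -- `unit i`.
  candidate : ∀ i → ∃[ T ] T ≋ unit i - α - β ⟨ L ⟩ × All (Solves T) es
  candidate i = solve-system (unit i - α - β)

  -- The gcd g divides b - 1, hence `L`. Modulo g the value is both 0 and a unit, so g divides 1.
  gcd≡1 : ∀ {i t} → + t ≋ unit i - α - β ⟨ L ⟩ → gcd (+ t * B ^ t + α + β) (B - 1ℤ) ≡ 1ℤ
  gcd≡1 {i} {t} t≋ = cong +_ (ℕ.∣1⇒≡1 (∣⇒∣ᵤ (≋0⇒∣ 1≋0)))
    where
    value = + t * B ^ t + α + β
    g = ℕ.gcd ∣ value ∣ ∣ B - 1ℤ ∣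
    g∣b∸1 : g ℕ.∣ b ℕ.∸ 1
    g∣b∸1 = subst (g ℕ.∣_) (cong ∣_∣ (sym (pos-∸ b≥1))) (ℕ.gcd[m,n]∣n ∣ value ∣ ∣ B - 1ℤ ∣)
    mod-L : ∀ {y z} → y ≋ z ⟨ L ⟩ → y ≋ z ⟨ g ⟩
    mod-L = ≋-weaken (ℕ.∣-trans g∣b∸1 (n∣lcm[m,n] (smooth q) (b ℕ.∸ 1)))
    B^t≋1 : B ^ t ≋ 1ℤ ⟨ g ⟩
    B^t≋1 = ≋-trans (≋-^ t (≋-intro (∣ᵤ⇒∣ (ℕ.gcd[m,n]∣n ∣ value ∣ ∣ B - 1ℤ ∣)))) (≋-reflexive (ℤ.^-zeroˡ t))
    lemma : ∀ u α β → (u - α - β) * 1ℤ + α + β ≡ u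
    lemma = solve-∀
    value≋unit : value ≋ unit i ⟨ g ⟩
    value≋unit = ≋-trans (≋-+ (≋-+ (≋-* (mod-L t≋) B^t≋1) (≋-refl {α})) (≋-refl {β})) (≋-reflexive (lemma (unit i) α β))
    1≋0 : 1ℤ ≋ 0ℤ ⟨ g ⟩
    1≋0 = ≋-trans (≋-sym (mod-L (unit*unit⁻¹≋1 i)))
      (≋-* (≋-trans (≋-sym value≋unit) (∣⇒≋0 (∣ᵤ⇒∣ (ℕ.gcd[m,n]∣m ∣ value ∣ ∣ B - 1ℤ ∣)))) (≋-refl {unit⁻¹ i}))

  -- Classes modulo M and compositeness.

  module Modulus (M : ℕ) (L∣M : L ℕ.∣ M) (smooth*q∣M : smooth q ℕ.* q ℕ.∣ M)
                 (prime∣M : ∀ {e} → e ∈ es → prime e ℕ.∣ M) (P-attained : ∃[ e ] e ∈ es × prime e ≡ P)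
                 (prime≤P : ∀ {e} → e ∈ es → prime e ℕ.≤ P)
                 (covered : ∀ n → ∃[ e ] e ∈ es × n ≡ residue (congruence e) [mod modulus (congruence e) ]) where

    InClass : Fin 3 → ℕ → Set
    InClass i t = + t ≡ proj₁ (candidate i) [mod M ]

    in-class : ∀ {i t k} → k ℕ.∣ M → InClass i t → + t ≋ proj₁ (candidate i) ⟨ k ⟩
    in-class {i} {t} k∣M c = ≋-weaken k∣M (fromMod (+ t) (proj₁ (candidate i)) M c)

    in-class-unit : ∀ {i t} → InClass i t → + t ≋ unit i - α - β ⟨ L ⟩
    in-class-unit {i} {t} c = ≋-trans (in-class {i} {t} L∣M c) (proj₁ (proj₂ (candidate i)))

    modulus∣M : ∀ {e} → e ∈ es → modulus (congruence e) ℕ.∣ M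
    modulus∣M e∈es = ℕ.∣-trans (prescribed∣ (prescribed e∈es)) smooth*q∣M

    classes-disjoint : ∀ {i j t} → InClass i t → InClass j t → i ≡ j
    classes-disjoint {i} {j} {t} c c′ = unit-injective (subst₂ (λ x y → x ≋ y ⟨ L ⟩)
      (lemma (unit i) α β) (lemma (unit j) α β)
      (≋-+ (≋-trans (≋-sym (in-class-unit {i} {t} c)) (in-class-unit {j} {t} c′)) (≋-refl {α + β})))
      where
      lemma : ∀ u α β → u - α - β + (α + β) ≡ u
      lemma = solve-∀

    -- P is the prime of some entry, and both classes solve that entry.
    classes-congruent : ∀ {i j s t} → InClass i s → InClass j t → + growth s ≋ + growth t ⟨ P ⟩
    classes-congruent {i} {j} {s} {t} c c′ = let e , e∈es , eq = P-attained in
      subst (λ p → + growth s ≋ + growth t ⟨ p ⟩) eq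
        (solutions-growth e {proj₁ (candidate i)} {proj₁ (candidate j)}
          (All.lookup (proj₂ (proj₂ (candidate i))) e∈es) (All.lookup (proj₂ (proj₂ (candidate j))) e∈es)
          (in-class {i} {s} (modulus∣M e∈es) c) (in-class {i} {s} (prime∣M e∈es) c)
          (in-class {j} {t} (modulus∣M e∈es) c′) (in-class {j} {t} (prime∣M e∈es) c′))

    -- The congruence covering n supplies a prime that divides the value; it is at most P, and
    -- without exception the absolute value is larger than P.
    unexceptional⇒composite : ∀ {i t n} → InClass i t → + P ≤ leading t * B + β → 1 ℕ.≤ n →
      ¬ Exceptional t n → Compositeℤ (term t n)
    unexceptional⇒composite {i} {t} {n} c P≤ n≥1 ¬exc =
      let e , e∈es , n≡r = covered (+ n) in
      ℕ.hasNonTrivialDivisor {{prime⇒nonTrivial (isPrime (isPrimitive e))}}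
        (ℕ.≤-<-trans (prime≤P e∈es) (ℕ.≰⇒> λ ∣term∣≤P →
          let lo , up = ∣i∣≤n⇒bounds (term t n) ∣term∣≤P
          in ¬exc (record { initial = P≤ ; positive = n≥1 ; lower = lo ; upper = up })))
        (∣⇒∣ᵤ (≋0⇒∣ (All.lookup (proj₂ (proj₂ (candidate i))) e∈es t n
          (in-class {i} {t} (modulus∣M e∈es) c) (in-class {i} {t} (prime∣M e∈es) c)
          (fromMod (+ n) (residue (congruence e)) (modulus (congruence e)) n≡r))))

    conclusion : ∃[ T ] (∀ t → + t ≡ T [mod M ] → leading t * B + β ≥ + P →
      gcd (+ t * B ^ t + α + β) (B - 1ℤ) ≡ 1ℤ × (∀ n → n ℕ.≥ 1 → Compositeℤ (term t n)))
    conclusion =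
      let i , unexceptional = avoid-exceptional InClass
            (λ i t → M ℕ.∣? ∣ + t - proj₁ (candidate i) ∣)
            (λ {i} {j} {t} → classes-disjoint {i} {j} {t}) (λ {i} {j} {s} {t} → classes-congruent {i} {j} {s} {t})
      in proj₁ (candidate i) , λ t c P≤ → gcd≡1 {i} {t} (in-class-unit {i} {t} c)
        , λ n n≥1 → unexceptional⇒composite {i} {t} {n} c P≤ n≥1 (unexceptional t n c)

-- From the covering system to the list of entries.

theorem3p3 : (b : ℕ) → b ℕ.≥ 3 →
    (α β : ℤ) → α * β ≢ 0ℤ →
    (q : ℕ) → Prime q → q ℕ.≥ 5 →
    (C : CoveringSystem) → HasPrescribedModuli q C →
    (P : BPrimitive b C) →
    let M = lcmList (2 ℕ.^ q ∷ 3 ℕ.^ q ∷ b ℕ.∸ 1 ∷ q ∷ primes P) in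
    ∃[ T ] ((t : ℕ) → (+ t) ≡ T [mod M ] →
    ((+ t) * (+ b) ^ t + α) * (+ b) + β ≥ + maxPrime P →
    gcd ((+ t) * (+ b) ^ t + α + β) ((+ b) - 1ℤ) ≡ 1ℤ
    × ((n : ℕ) → n ℕ.≥ 1 →
    Compositeℤ (((+ t) * (+ b) ^ t + α) * (+ b) ^ n + β)))
theorem3p3 b b≥3 α β _ q prime-q q≥5 C C-moduli P = conclusion
  where
  decomposition = entries (congruences C) (areDivisors P)
  es = proj₁ decomposition
  es-congruences = proj₁ (proj₂ decomposition)
  es-primes = proj₂ (proj₂ decomposition)

  ns = 2 ℕ.^ q ∷ 3 ℕ.^ q ∷ b ℕ.∸ 1 ∷ q ∷ primes P
  M = lcmList ns

  prescribed : ∀ {e} → e ∈ es → modulus (congruence e) ∈ prescribedModuli q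
  prescribed e∈es = ∈-resp-↭ C-moduli (∈-map⁺ modulus (subst (_ ∈_) es-congruences (∈-map⁺ congruence e∈es)))

  open System b b≥3 α β q prime-q q≥5 (maxPrime P) es (subst Unique (sym es-primes) (distinct P)) prescribed

  prime∈ : ∀ {e} → e ∈ es → prime e ∈ primes P
  prime∈ e∈es = subst (_ ∈_) es-primes (∈-map⁺ prime e∈es)

  prime≤max : ∀ {e} → e ∈ es → prime e ℕ.≤ maxPrime P
  prime≤max e∈es = All.lookup (xs≤max 0 (primes P)) (prime∈ e∈es)

  covered : ∀ n → ∃[ e ] e ∈ es × n ≡ residue (congruence e) [mod modulus (congruence e) ]
  covered n = find (Any.map⁻ (subst (Any _) (sym es-congruences) (covers C n)))

  -- The maximum is not the default 0: the congruence covering the integer 0 has a positive prime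
  -- below or equal to it.
  max-attained : ∃[ e ] e ∈ es × prime e ≡ maxPrime P
  max-attained with argmax-sel id 0 (primes P)
  ... | inj₁ max≡0 = let e , e∈es , _ = covered 0ℤ in
    contradiction (subst (prime e ℕ.≤_) max≡0 (prime≤max e∈es))
      (ℕ.<⇒≱ (ℕ.>-nonZero⁻¹ (prime e) {{prime⇒nonZero (isPrime (isPrimitive e))}}))
  ... | inj₂ max∈ with e , e∈es , eq ← ∈-map⁻ prime (subst (maxPrime P ∈_) (sym es-primes) max∈) =
    e , e∈es , sym eq

  -- M is a least common multiple, so the product divides it because 2^q and 3^q are coprime.
  smooth∣M : smooth q ℕ.∣ M
  smooth∣M = coprime⇒*∣
    (Coprimality.sym (coprime-^ (Coprimality.sym (coprime-^ (prime≢⇒coprime prime[2] prime[3] λ ()) q)) q))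
    (∣-lcmList {ns = ns} (here refl)) (∣-lcmList {ns = ns} (there (here refl)))

  open Modulus M
    (lcm-least smooth∣M (∣-lcmList {ns = ns} (there (there (here refl)))))
    (coprime⇒*∣ (Coprimality.sym (>3⇒coprime-smooth prime-q (ℕ.≤-trans (ℕ.n≤1+n 4) q≥5)))
      smooth∣M (∣-lcmList {ns = ns} (there (there (there (here refl))))))
    (λ e∈es → ∣-lcmList {ns = ns} (there (there (there (there (prime∈ e∈es))))))
    max-attained prime≤max covered
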